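{- Let $N\ge 1$ and let $\phi^2$ be the $\mathcal{T}$-formula, defined in the context, that is the quadratic-size partial-order encoding of the $N$-thread challenge problem. Then every Fixed-Alphabet-DPLL($\mathcal{T}$) proof that $\phi^2$ is unsatisfiable contains at least $N!$ applications of the rule $\mathcal{T}$-learn.
   Context: Challenge problem. A shared memory location $x$ initially holds $0$. Thread $T_0$ reads $[x]$ into $v_0$ (read event $r_{assert}$) and asserts $v_0\le N$. For $i=1,\dots,N$, thread $T_i$ reads $[x]$ into $v_i$ (read event $r_i$) and then writes $v_i+1$ to $x$ (write event $w_i$). The initialization is a write event $w_{init}$. Put $\mathsf{R}=\{r_1,\dots,r_N,r_{assert}\}$, $\mathsf{W}=\{w_{init},w_1,\dots,w_N\}$, $\mathsf{E}=\mathsf{R}\cup\mathsf{W}$, so $|\mathsf{E}|=2N+2$. Theories. $\mathcal{T}=\mathcal{T}_C+\mathcal{T}_V+\mathcal{T}_S$ is the standard combined (many-sorted, with separate sorts for clocks, values and selections) theory, where: $\mathcal{T}_C$ (clocks) has a strict order relation $\prec$ that is a total order, with non-strict version $\preceq$; $\mathcal{T}_V$ (values) is bit-vector, Presburger, or real arithmetic; $\mathcal{T}_S$ (selection) is an uninterpreted theory (with equality). It is assumed that $\mathcal{T}$ has a model whose clock domain has at least $|\mathsf{E}|$ elements and whose selection domain has at least $N+1$ elements, and, if $\mathcal{T}_V$ is bit-vector arithmetic, that the bit-width is large enough that the constants $0,1,\dots,N+1$ are represented as distinct values in their usual order, without overflow. Variables: a $\mathcal{T}_C$-variable $\mathsf{c}_e$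 and a $\mathcal{T}_S$-variable $\mathsf{s}_e$ for each $e\in\mathsf{E}$; a $\mathcal{T}_V$-variable $\mathsf{rv}_r$ and a $\mathcal{T}_C$-variable $\mathsf{sup}_r$ for each $r\in\mathsf{R}$. Formula. $\phi^2$ is the conjunction of the following clauses (implications are read as clauses, $a\neq b$ is the negation of the atom $a=b$, and the atoms $a=b$ and $b=a$ are identified): 1. $\mathsf{c}_{w_{init}}\prec\mathsf{c}_{r_{assert}}$; and $\mathsf{c}_{w_{init}}\prec\mathsf{c}_{r_i}$, $\mathsf{c}_{r_i}\prec\mathsf{c}_{w_i}$ for $i=1,\dots,N$; 2. $\mathsf{c}_w\neq\mathsf{c}_{w'}$ and $\mathsf{s}_w\neq\mathsf{s}_{w'}$ for all $w\neq w'$ in $\mathsf{W}$; 3. $\mathsf{c}_w\neq\mathsf{c}_r$ for all $w\in\mathsf{W}$, $r\in\mathsf{R}$; 4. $(\mathsf{s}_w=\mathsf{s}_r)\Rightarrow\mathsf{c}_w=\mathsf{sup}_r$ and $(\mathsf{s}_w=\mathsf{s}_r)\Rightarrow\mathsf{c}_w\prec\mathsf{c}_r$ for all $w\in\mathsf{W}$, $r\in\mathsf{R}$; 5. $(\mathsf{s}_{w_{init}}=\mathsf{s}_r)\Rightarrow 0=\mathsf{rv}_r$ for all $r\in\mathsf{R}$; 6. $(\mathsf{s}_{w_i}=\mathsf{s}_r)\Rightarrow\mathsf{rv}_{r_i}+1=\mathsf{rv}_r$ for all $i=1,\dots,N$, $r\in\mathsf{R}$; 7. $(\mathsf{c}_w\preceq\mathsf{c}_r)\Rightarrow\mathsf{c}_w\preceq\mathsf{sup}_r$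 for all $w\in\mathsf{W}$, $r\in\mathsf{R}$; 8. $\bigvee_{w\in\mathsf{W}}\mathsf{s}_w=\mathsf{s}_r$ for all $r\in\mathsf{R}$; 9. $\mathsf{rv}_{r_{assert}}>N$. Proofs. Let $\mathcal{A}$ be the set of $\mathcal{T}$-atoms of the formula, $\mathcal{L}_{\mathcal{A}}$ the set of literals over $\mathcal{A}$, and $(\cdot)^{\mathbb{B}}$ an injective map from $\mathcal{A}$ into a set $\mathcal{X}$ of propositional variables, lifted to literals and sets of literals. Clauses are finite sets of literals, read as disjunctions. Let $C_1,\dots,C_\alpha$ be the propositional abstractions of the clauses of the formula. A Fixed-Alphabet-DPLL($\mathcal{T}$) proof of its unsatisfiability is a finite sequence of clauses $C_1,\dots,C_\alpha,\dots,C_\beta=\Box$ (the empty clause), where each $C_k$ with $\alpha<k\le\beta$ is derived by one of two rules: (Res) $C_k$ is the propositional resolvent $(C_i\setminus\{\ell\})\cup(C_j\setminus\{\lnot\ell\})$ of two earlier clauses with $i\ne j$, $\ell\in C_i$, $\lnot\ell\in C_j$; ($\mathcal{T}$-learn) $C_k=L^{\mathbb{B}}$ for some $L\subseteq\mathcal{L}_{\mathcal{A}}$ with $\models_{\mathcal{T}}\bigvee_{t\in L}t$. The number of applications of $\mathcal{T}$-learn is the number of indices $k\in(\alpha,\beta]$ whose clause is derived by $\mathcal{T}$-learn. -}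

module Defs where

open import Data.Bool.Base using (if_then_else_)
open import Data.Fin.Base using (Fin; toℕ)
open import Data.Integer.Base as ℤ using (ℤ)
open import Data.List.Base
  using (List; []; _∷_; _++_; _∷ʳ_; [_]; map; concatMap; allFin; length; lookup)
open import Data.List.Membership.Propositional using (_∈_)
open import Data.List.Relation.Binary.BagAndSetEquality using (_∼[_]_; set)
open import Data.List.Relation.Unary.All using (All)
open import Data.List.Relation.Unary.Any using (Any)
open import Data.Nat.Base as ℕ using (ℕ; suc; _^_)
open import Data.Nat.DivMod using (_mod_)
import Data.Nat.Properties as ℕ
open import Data.Product.Base using (∃; Σ; _×_; _,_; proj₁; proj₂)
open import Data.Rational.Base as ℚ using (ℚ; 0ℚ; ½; ∣_∣)
import Data.Rational.Properties as ℚ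
open import Data.Rational.Solver using (module +-*-Solver)
open import Data.Sum.Base using (_⊎_)
open import Data.Unit.Base using (⊤)
open import Function.Bundles using (_⇔_; Injection)
open import Level using (Level; 0ℓ; _⊔_) renaming (suc to lsuc)
open import Relation.Binary.Bundles using (Setoid; StrictTotalOrder)
open import Relation.Binary.Core using (Rel)
import Relation.Binary.Construct.StrictToNonStrict as ToNonStrict
open import Relation.Binary.PropositionalEquality
  using (_≡_; _≢_; refl; sym; trans; cong; subst; setoid)
import Relation.Binary.PropositionalEquality.Properties as ≡
open import Relation.Binary.Structures using (IsEquivalence)
open import Relation.Nullary using (¬_)
open import Relation.Unary using (Pred)

-- The real numbers, as Cauchy sequences of rationals.

record ℝ : Set where
  field
    seq    : ℕ → ℚ
    cauchy : ∀ {ε} → 0ℚ ℚ.< ε →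
             ∃ λ k → ∀ {m n} → k ℕ.≤ m → k ℕ.≤ n → ∣ seq m ℚ.- seq n ∣ ℚ.< ε

open ℝ

infix 4 _≈ℝ_ _<ℝ_

_≈ℝ_ : Rel ℝ 0ℓ
x ≈ℝ y = ∀ {ε} → 0ℚ ℚ.< ε →
         ∃ λ k → ∀ {n} → k ℕ.≤ n → ∣ seq x n ℚ.- seq y n ∣ ℚ.< ε

_<ℝ_ : Rel ℝ 0ℓ
x <ℝ y = ∃ λ ε → 0ℚ ℚ.< ε ×
         ∃ λ k → ∀ {n} → k ℕ.≤ n → seq x n ℚ.+ ε ℚ.< seq y n

private
  0<½* : ∀ {ε} → 0ℚ ℚ.< ε → 0ℚ ℚ.< ½ ℚ.* ε
  0<½* = ℚ.*-monoʳ-<-pos ½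

  halves : ∀ {ε p q r} → p ≡ q ℚ.+ r →
           ∣ q ∣ ℚ.< ½ ℚ.* ε → ∣ r ∣ ℚ.< ½ ℚ.* ε → ∣ p ∣ ℚ.< ε
  halves {ε} {_} {q} {r} refl q< r< =
    ℚ.≤-<-trans (ℚ.∣p+q∣≤∣p∣+∣q∣ q r)
      (subst (∣ q ∣ ℚ.+ ∣ r ∣ ℚ.<_) (twoHalves ε) (ℚ.+-mono-< q< r<))
    where
    open +-*-Solver
    twoHalves : ∀ δ → ½ ℚ.* δ ℚ.+ ½ ℚ.* δ ≡ δ
    twoHalves = solve 1 (λ δ → con ½ :* δ :+ con ½ :* δ := δ) refl

  ∣p-p∣<ε : ∀ p {ε} → 0ℚ ℚ.< ε → ∣ p ℚ.- p ∣ ℚ.< ε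
  ∣p-p∣<ε p 0<ε rewrite ℚ.+-inverseʳ p = 0<ε

  ∣p-q∣≡∣q-p∣ : ∀ p q → ∣ p ℚ.- q ∣ ≡ ∣ q ℚ.- p ∣
  ∣p-q∣≡∣q-p∣ p q =
    trans (sym (ℚ.∣-p∣≡∣p∣ (p ℚ.- q)))
          (cong ∣_∣ (solve 2 (λ p q → :- (p :- q) := q :- p) refl p q))
    where open +-*-Solver

fromℚ : ℚ → ℝ
seq    (fromℚ q) _   = q
cauchy (fromℚ q) 0<ε = 0 , λ _ _ → ∣p-p∣<ε q 0<ε

_+ℝ_ : ℝ → ℝ → ℝ
seq    (x +ℝ y) n   = seq x n ℚ.+ seq y n
cauchy (x +ℝ y) 0<ε with cauchy x (0<½* 0<ε) | cauchy y (0<½* 0<ε)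
... | k , x-close | l , y-close = k ℕ.+ l , λ {m} {n} k+l≤m k+l≤n →
  halves (regroup (seq x m) (seq y m) (seq x n) (seq y n))
    (x-close (ℕ.m+n≤o⇒m≤o k k+l≤m) (ℕ.m+n≤o⇒m≤o k k+l≤n))
    (y-close (ℕ.m+n≤o⇒n≤o k k+l≤m) (ℕ.m+n≤o⇒n≤o k k+l≤n))
  where
  open +-*-Solver
  regroup : ∀ a b c d →
            (a ℚ.+ b) ℚ.- (c ℚ.+ d) ≡ (a ℚ.- c) ℚ.+ (b ℚ.- d)
  regroup = solve 4
    (λ a b c d → (a :+ b) :- (c :+ d) := (a :- c) :+ (b :- d)) refl

≈ℝ-isEquivalence : IsEquivalence _≈ℝ_
≈ℝ-isEquivalence = record
  { refl  = λ {x} 0<ε → 0 , λ {n} _ → ∣p-p∣<ε (seq x n) 0<ε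
  ; sym   = λ {x} {y} x≈y 0<ε → proj₁ (x≈y 0<ε) , λ {n} k≤n →
      subst (ℚ._< _) (∣p-q∣≡∣q-p∣ (seq x n) (seq y n)) (proj₂ (x≈y 0<ε) k≤n)
  ; trans = λ {x} {y} {z} x≈y y≈z 0<ε →
      let k , x-y = x≈y (0<½* 0<ε)
          l , y-z = y≈z (0<½* 0<ε)
      in k ℕ.+ l , λ {n} k+l≤n →
         halves (telescope (seq x n) (seq y n) (seq z n))
           (x-y (ℕ.m+n≤o⇒m≤o k k+l≤n)) (y-z (ℕ.m+n≤o⇒n≤o k k+l≤n))
  }
  where
  open +-*-Solver
  telescope : ∀ a b c → a ℚ.- c ≡ (a ℚ.- b) ℚ.+ (b ℚ.- c)
  telescope = solve 3 (λ a b c → a :- c := (a :- b) :+ (b :- c)) refl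

-- The value theories.  Only the symbols occurring in the encoding (numerals,
-- addition and the order) are interpreted: the others do not affect the
-- validity of clauses over its atoms.

data Signedness : Set where
  unsigned signed : Signedness

-- Presburger arithmetic is read either over ℕ or, as in SMT solvers, over ℤ.
data ValueTheory : Set where
  bitVector   : Signedness → (width : ℕ) → ValueTheory
  presburgerℕ : ValueTheory
  presburgerℤ : ValueTheory
  real        : ValueTheory

record ValueStructure : Set₁ where
  field
    Carrier       : Set
    _≈_           : Rel Carrier 0ℓ
    isEquivalence : IsEquivalence _≈_
    _<_           : Rel Carrier 0ℓ
    _+_           : Carrier → Carrier → Carrier
    numeral       : ℕ → Carrier

BV : ℕ → Set
BV k = Fin (2 ^ k)

bv : ∀ k → ℕ → BV k
bv k n = _mod_ n (2 ^ k) {{ℕ.m^n≢0 2 k}}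

-- The number denoted by a bit-vector; `signed` is two's complement.
bvToℤ : Signedness → ∀ k → BV k → ℤ
bvToℤ unsigned k x = ℤ.+ toℕ x
bvToℤ signed   k x =
  if 2 ℕ.* toℕ x ℕ.<ᵇ 2 ^ k
  then ℤ.+ toℕ x
  else ℤ.+ toℕ x ℤ.- ℤ.+ (2 ^ k)

valueStructure : ValueTheory → ValueStructure
valueStructure (bitVector s k) = record
  { Carrier       = BV k
  ; _≈_           = _≡_
  ; isEquivalence = ≡.isEquivalence
  ; _<_           = λ x y → bvToℤ s k x ℤ.< bvToℤ s k y
  ; _+_           = λ x y → bv k (toℕ x ℕ.+ toℕ y)
  ; numeral       = bv k
  }
valueStructure presburgerℕ = record
  { Carrier       = ℕ
  ; _≈_           = _≡_
  ; isEquivalence = ≡.isEquivalence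
  ; _<_           = ℕ._<_
  ; _+_           = ℕ._+_
  ; numeral       = λ n → n
  }
valueStructure presburgerℤ = record
  { Carrier       = ℤ
  ; _≈_           = _≡_
  ; isEquivalence = ≡.isEquivalence
  ; _<_           = ℤ._<_
  ; _+_           = ℤ._+_
  ; numeral       = ℤ.+_
  }
valueStructure real = record
  { Carrier       = ℝ
  ; _≈_           = _≈ℝ_
  ; isEquivalence = ≈ℝ-isEquivalence
  ; _<_           = _<ℝ_
  ; _+_           = _+ℝ_
  ; numeral       = λ n → fromℚ (ℤ.+ n ℚ./ 1)
  }

-- 0, 1, …, n are represented without overflow; in particular they are
-- distinct and, since bit-vectors are compared through `bvToℤ`, in their
-- usual order.
Representable : ValueTheory → ℕ → Set
Representable (bitVector s k) n = ∀ {i} → i ℕ.≤ n → bvToℤ s k (bv k i) ≡ ℤ.+ i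
Representable presburgerℕ     n = ⊤
Representable presburgerℤ     n = ⊤
Representable real            n = ⊤

-- The combined theory.  The sorts being disjoint, a model of the combination
-- is one model of each component.  The clock theory is an arbitrary class of
-- strict total orders; the selection theory is uninterpreted, so every set
-- is a model of it.

record Theory (ℓ : Level) : Set (lsuc ℓ) where
  field
    ClockModel  : Pred (StrictTotalOrder 0ℓ 0ℓ 0ℓ) ℓ
    valueTheory : ValueTheory

  value : ValueStructure
  value = valueStructure valueTheory

record Model {ℓ} (𝒯 : Theory ℓ) : Set (lsuc 0ℓ ⊔ ℓ) where
  open Theory 𝒯
  field
    clock      : StrictTotalOrder 0ℓ 0ℓ 0ℓ
    clockModel : ClockModel clock
    selection  : Setoid 0ℓ 0ℓ

AtLeast : ℕ → Setoid 0ℓ 0ℓ → Set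
AtLeast n S = Injection (setoid (Fin n)) S

data Read (N : ℕ) : Set where
  r       : Fin N → Read N
  rAssert : Read N

data Write (N : ℕ) : Set where
  wInit : Write N
  w     : Fin N → Write N

data Event (N : ℕ) : Set where
  rd : Read N → Event N
  wr : Write N → Event N

module _ (N : ℕ) where

  reads : List (Read N)
  reads = rAssert ∷ map r (allFin N)

  writes : List (Write N)
  writes = wInit ∷ map w (allFin N)

data Sort : Set where
  clk val sel : Sort

infixl 6 _∔_
infix  5 _≐_ _≺_ _⪯_ _≻_

data Term (N : ℕ) : Sort → Set where
  c   : Event N → Term N clk
  sup : Read N → Term N clk
  s   : Event N → Term N sel
  rv  : Read N → Term N val
  num : ℕ → Term N val
  _∔_ : Term N val → Term N val → Term N val

data Atom (N : ℕ) : Set where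
  _≐_ : ∀ {σ} → Term N σ → Term N σ → Atom N
  _≺_ : Term N clk → Term N clk → Atom N
  _⪯_ : Term N clk → Term N clk → Atom N
  _≻_ : Term N val → Term N val → Atom N

-- Identity of atoms: t ≐ u and u ≐ t are the same atom.
infix 4 _≅_

data _≅_ {N : ℕ} : Rel (Atom N) 0ℓ where
  same : ∀ {a} → a ≅ a
  swap : ∀ {σ} {t u : Term N σ} → (t ≐ u) ≅ (u ≐ t)

data Literal {a} (A : Set a) : Set a where
  pos neg : A → Literal A

module _ {a} {A : Set a} where

  atom : Literal A → A
  atom (pos x) = x
  atom (neg x) = x

  ~_ : Literal A → Literal A
  ~ pos x = neg x
  ~ neg x = pos x

mapLiteral : ∀ {a b} {A : Set a} {B : Set b} → (A → B) → Literal A → Literal B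
mapLiteral f (pos x) = pos (f x)
mapLiteral f (neg x) = neg (f x)

-- Finite sets of literals; clauses are only ever compared as sets.
Clause : ∀ {a} → Set a → Set a
Clause A = List (Literal A)

Formula : ℕ → Set
Formula N = List (Clause (Atom N))

-- Each pair of distinct positions once, since t ≐ u and u ≐ t are one atom.
unorderedPairs : ∀ {a} {A : Set a} → List A → List (A × A)
unorderedPairs []       = []
unorderedPairs (x ∷ xs) = map (x ,_) xs ++ unorderedPairs xs

module _ {N : ℕ} where

  infix 4 _⇒_

  _⇒_ : Atom N → Atom N → Clause (Atom N)
  a ⇒ b = neg a ∷ pos b ∷ []

  fact : Atom N → Clause (Atom N)
  fact a = [ pos a ]

  notEqual : ∀ {σ} → Term N σ → Term N σ → Clause (Atom N)
  notEqual t u = [ neg (t ≐ u) ]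

forAll : ∀ {a b} {A : Set a} {B : Set b} → List A → (A → List B) → List B
forAll xs f = concatMap f xs

φ² : ∀ N → Formula N
φ² N =
     fact (c (wr wInit) ≺ c (rd rAssert))
   ∷ forAll (allFin N) (λ i →
        fact (c (wr wInit) ≺ c (rd (r i)))
      ∷ fact (c (rd (r i)) ≺ c (wr (w i)))
      ∷ [])
  ++ forAll (unorderedPairs (writes N)) (λ (x , y) →
        notEqual (c (wr x)) (c (wr y))
      ∷ notEqual (s (wr x)) (s (wr y))
      ∷ [])
  ++ forAll (writes N) (λ x → forAll (reads N) λ y →
        notEqual (c (wr x)) (c (rd y))
      ∷ (s (wr x) ≐ s (rd y) ⇒ c (wr x) ≐ sup y)
      ∷ (s (wr x) ≐ s (rd y) ⇒ c (wr x) ≺ c (rd y))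
      ∷ (c (wr x) ⪯ c (rd y) ⇒ c (wr x) ⪯ sup y)
      ∷ [])
  ++ forAll (reads N) (λ y →
        (s (wr wInit) ≐ s (rd y) ⇒ num 0 ≐ rv y)
      ∷ forAll (allFin N) (λ i →
           (s (wr (w i)) ≐ s (rd y) ⇒ rv (r i) ∔ num 1 ≐ rv y)
         ∷ []))
  ++ forAll (reads N) (λ y →
        map (λ x → pos (s (wr x) ≐ s (rd y))) (writes N)
      ∷ [])
  ++ fact (rv rAssert ≻ num N)
   ∷ []

module Semantics {ℓ} {𝒯 : Theory ℓ} (M : Model 𝒯) (N : ℕ) where

  open Theory 𝒯
  open Model M
  private
    module C = StrictTotalOrder clock
    module S = Setoid selection
    module V = ValueStructure value

  ⟦_⟧ˢ : Sort → Set
  ⟦ clk ⟧ˢ = C.Carrier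
  ⟦ val ⟧ˢ = V.Carrier
  ⟦ sel ⟧ˢ = S.Carrier

  ⟦≐⟧ : ∀ σ → Rel ⟦ σ ⟧ˢ 0ℓ
  ⟦≐⟧ clk = C._≈_
  ⟦≐⟧ val = V._≈_
  ⟦≐⟧ sel = S._≈_

  record Assignment : Set where
    field
      cᵃ   : Event N → C.Carrier
      supᵃ : Read N → C.Carrier
      sᵃ   : Event N → S.Carrier
      rvᵃ  : Read N → V.Carrier

  module _ (α : Assignment) where
    open Assignment α

    ⟦_⟧ᵗ : ∀ {σ} → Term N σ → ⟦ σ ⟧ˢ
    ⟦ c e ⟧ᵗ   = cᵃ e
    ⟦ sup y ⟧ᵗ = supᵃ y
    ⟦ s e ⟧ᵗ   = sᵃ e
    ⟦ rv y ⟧ᵗ  = rvᵃ y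
    ⟦ num n ⟧ᵗ = V.numeral n
    ⟦ t ∔ u ⟧ᵗ = ⟦ t ⟧ᵗ V.+ ⟦ u ⟧ᵗ

    ⟦_⟧ᵃ : Atom N → Set
    ⟦ _≐_ {σ} t u ⟧ᵃ = ⟦≐⟧ σ ⟦ t ⟧ᵗ ⟦ u ⟧ᵗ
    ⟦ t ≺ u ⟧ᵃ       = ⟦ t ⟧ᵗ C.< ⟦ u ⟧ᵗ
    ⟦ t ⪯ u ⟧ᵃ       = ToNonStrict._≤_ C._≈_ C._<_ ⟦ t ⟧ᵗ ⟦ u ⟧ᵗ
    ⟦ t ≻ u ⟧ᵃ       = ⟦ u ⟧ᵗ V.< ⟦ t ⟧ᵗ

    ⟦_⟧ˡ : Literal (Atom N) → Set
    ⟦ pos a ⟧ˡ = ⟦ a ⟧ᵃ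
    ⟦ neg a ⟧ˡ = ¬ ⟦ a ⟧ᵃ

-- Validity of a clause in classical logic, hence the double negation of the
-- constructive disjunction.
infix 4 _⊨_

_⊨_ : ∀ {ℓ N} → Theory ℓ → Clause (Atom N) → Set (lsuc 0ℓ ⊔ ℓ)
_⊨_ {N = N} 𝒯 L =
  (M : Model 𝒯) → let open Semantics M N in
  (α : Assignment) → ¬ ¬ Any ⟦ α ⟧ˡ L

_∈Atoms_ : ∀ {N} → Atom N → Formula N → Set
a ∈Atoms φ = Any (Any (λ l → atom l ≅ a)) φ

-- The map is total on `Atom N` for convenience, but required to be injective
-- only on the atoms of φ.  It is a map on atoms up to identity.
record Abstraction {N} (φ : Formula N) (𝒳 : Set) : Set where
  field
    _ᴮ        : Atom N → 𝒳
    cong-ᴮ    : ∀ {a b} → a ≅ b → a ᴮ ≡ b ᴮ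
    injective : ∀ {a b} → a ∈Atoms φ → b ∈Atoms φ → a ᴮ ≡ b ᴮ → a ≅ b

  clauseᴮ : Clause (Atom N) → Clause 𝒳
  clauseᴮ = map (mapLiteral _ᴮ)

-- E = (C \ {l}) ∪ (D \ {~ l}), with l ∈ C and ~ l ∈ D.
record Resolvent {𝒳 : Set} (l : Literal 𝒳) (C D E : Clause 𝒳) : Set where
  field
    l∈C     : l ∈ C
    ~l∈D    : (~ l) ∈ D
    members : ∀ {m} → m ∈ E ⇔ ((m ∈ C × m ≢ l) ⊎ (m ∈ D × m ≢ ~ l))

module _ {ℓ} (𝒯 : Theory ℓ) {N} (φ : Formula N) {𝒳 : Set}
         (abs : Abstraction φ 𝒳) where

  open Abstraction abs

  data Derivation : List (Clause 𝒳) → Set (lsuc 0ℓ ⊔ ℓ) where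
    start : Derivation (map clauseᴮ φ)
    res   : ∀ {Γ} → Derivation Γ →
            (i j : Fin (length Γ)) → i ≢ j →
            ∀ l {E} → Resolvent l (lookup Γ i) (lookup Γ j) E →
            Derivation (Γ ∷ʳ E)
    learn : ∀ {Γ} → Derivation Γ →
            (L : Clause (Atom N)) → All (λ l → atom l ∈Atoms φ) L →
            𝒯 ⊨ L →
            ∀ {E} → E ∼[ set ] clauseᴮ L →
            Derivation (Γ ∷ʳ E)

  UnsatProof : Set (lsuc 0ℓ ⊔ ℓ)
  UnsatProof = Σ (List (Clause 𝒳)) λ Γ → Derivation (Γ ∷ʳ [])

  learnSteps : ∀ {Γ} → Derivation Γ → ℕ
  learnSteps start               = 0
  learnSteps (res δ _ _ _ _ _)   = learnSteps δ
  learnSteps (learn δ _ _ _ _)   = suc (learnSteps δ)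

  #learn : UnsatProof → ℕ
  #learn (_ , δ) = learnSteps δ

module Submission where

-- Every permutation of the threads yields a critical assignment: the sequential
-- execution in that order, which satisfies the whole formula if its false atom
-- rv_assert > N is declared true.  A clause falsified by the assignments of two
-- different permutations is not valid.  For let x be the write from which y
-- reads in the first execution but not in the second.  In the first execution
-- raise by one the values of y and of all later reads.  This
-- makes rv_assert = N + 1 and changes no other atom except the one equating rv_y
-- with the value written by x, on which the two assignments differ.  Hence a
-- learned clause is falsified by at most one critical assignment, while by
-- soundness of resolution each of them falsifies some learned clause.

open import Defs
open import Data.Nat.Base using (ℕ; suc; _≥_; _≤_; _+_; _*_; _!)
open import Data.Product.Base using (Σ-syntax; _×_)
open import Relation.Binary.Bundles using (module StrictTotalOrder)

import Algebra.Properties.Group as Group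
open import Data.Fin.Base as Fin
  using (Fin; zero; suc; toℕ; fromℕ; fromℕ<; inject₁; combine; remQuot; cast)
open import Data.Fin.Permutation
  using (Permutation′; _⟨$⟩ʳ_; _⟨$⟩ˡ_; _≈_; inverseʳ; insert; insert-punchIn; id)
import Data.Fin.Properties as Fin
open import Data.Integer.Base as ℤ using (+_; +<+)
import Data.Integer.Properties as ℤ
open import Data.List.Base
  using (List; []; _∷_; map; allFin; length; lookup; tabulate)
open import Data.List.Membership.Propositional using (_∈_; find; lose)
open import Data.List.Membership.Propositional.Properties using (∈-lookup; ∈-map⁺; ∈-allFin)
open import Data.List.Properties using (length-tabulate)
open import Data.List.Relation.Binary.BagAndSetEquality using (_∼[_]_; set)
import Data.List.Relation.Binary.Permutation.Propositional.Properties as ↭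
open import Data.List.Relation.Binary.Permutation.Setoid using (↭-sym)
open import Data.List.Relation.Binary.Permutation.Setoid.Properties using (Unique-resp-↭)
open import Data.List.Relation.Unary.All as All using (All; []; _∷_)
import Data.List.Relation.Unary.All.Properties as All
open import Data.List.Relation.Unary.AllPairs as AllPairs using (AllPairs; []; _∷_)
import Data.List.Relation.Unary.AllPairs.Properties as AllPairs
open import Data.List.Relation.Unary.Any as Any using (Any; here; there)
open import Data.List.Relation.Unary.Linked.Properties using (Linked⇒AllPairs)
open import Data.List.Relation.Unary.Unique.Propositional using (Unique)
import Data.List.Relation.Unary.Unique.Propositional.Properties as Unique
import Data.List.Sort as Sorting
open import Data.Nat.Base using (zero; _<_; _^_; z≤n; s≤s; z<s; s≤s⁻¹; s<s⁻¹)
open import Data.Nat.DivMod using (_%_; %-distribˡ-+; m%n<n)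
import Data.Nat.Properties as ℕ
open import Data.Product.Base using (∃; _,_; proj₁; proj₂; uncurry)
open import Data.Rational.Base as ℚ using (0ℚ; 1ℚ; ½; ∣_∣; toℚᵘ)
import Data.Rational.Properties as ℚ
open import Data.Rational.Unnormalised.Base as ℚᵘ using (mkℚᵘ; *≡*)
import Data.Rational.Unnormalised.Properties as ℚᵘ
open import Data.Sum.Base as Sum using (_⊎_; inj₁; inj₂)
open import Data.Unit.Base using (⊤; tt)
open import Function.Base using (_∘_; _$_)
open import Function.Bundles using (Injection; Equivalence; _⇔_; mk⇔)
open import Function.Properties.Inverse using (↔⇒↣)
open import Relation.Binary.Bundles using (StrictTotalOrder; module Setoid)
open import Relation.Binary.Core using (Rel)
open import Relation.Binary.Definitions using (tri<; tri≈; tri>)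
import Relation.Binary.Properties.StrictTotalOrder as StrictTotalOrderProperties
open import Relation.Binary.PropositionalEquality
  using (_≡_; _≢_; refl; sym; trans; cong; cong₂; subst; subst₂; setoid; module ≡-Reasoning)
open import Relation.Binary.Structures using (IsEquivalence)
open import Relation.Nullary using (¬_; Dec; yes; no; contradiction)
open import Relation.Nullary.Decidable using (¬?; decidable-stable)
open import Relation.Unary using (Decidable)

-- Critical assignments against resolution proofs.

module _ {a r p} {A : Set a} {R : Rel A r} {P : A → Set p} (P? : Decidable P)
         (R⇒P⊎P : ∀ {x y} → R x y → P x ⊎ P y) where

  -- Two related elements cannot both fail `P`, so at most one element of the list fails. With `P`
  -- read as satisfying a learned clause, one application of the rule eliminates at most one
  -- critical assignment.
  dropFailure : ∀ {xs} → AllPairs R xs →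
                ∃ λ ys → length xs ≤ suc (length ys) × AllPairs R ys ×
                         All P ys × All (_∈ xs) ys
  dropFailure [] = [] , z≤n , [] , [] , []
  dropFailure {x ∷ xs} (Rx ∷ Rxs) with P? x
  ... | no ¬Px = xs , ℕ.≤-refl , Rxs , All.map (other ∘ R⇒P⊎P) Rx , All.tabulate there
    where
    other : ∀ {y} → P x ⊎ P y → P y
    other (inj₁ Px) = contradiction Px ¬Px
    other (inj₂ Py) = Py
  ... | yes Px with dropFailure Rxs
  ... | ys , ∣xs∣≤ , Rys , Pys , ys⊆xs =
    x ∷ ys , s≤s ∣xs∣≤ , All.zipWith (λ { (_ , y∈xs) → All.lookup Rx y∈xs }) (Pys , ys⊆xs) ∷ Rys ,
    Px ∷ Pys , here refl ∷ All.map there ys⊆xs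

HoldsLiteral : ∀ {a p} {A : Set a} → (A → Set p) → Literal A → Set p
HoldsLiteral P (pos x) = P x
HoldsLiteral P (neg x) = ¬ P x

holdsLiteral? : ∀ {a p} {A : Set a} {P : A → Set p} → Decidable P → Decidable (HoldsLiteral P)
holdsLiteral? P? (pos x) = P? x
holdsLiteral? P? (neg x) = ¬? (P? x)

module CriticalAssignments
  {ℓ} (𝒯 : Theory ℓ) {N} (φ : Formula N) {𝒳 : Set} (abs : Abstraction φ 𝒳)
  {I : Set} (Holds : I → Atom N → Set) (holds? : ∀ i → Decidable (Holds i))
  (resp : ∀ {i a b} → a ≅ b → Holds i a → Holds i b)
  (models : ∀ i → All (Any (HoldsLiteral (Holds i))) φ)
  (separated : ∀ {i j} → i ≢ j → ∀ {L} → All (λ l → atom l ∈Atoms φ) L → 𝒯 ⊨ L →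
               Any (HoldsLiteral (Holds i)) L ⊎ Any (HoldsLiteral (Holds j)) L)
  where

  open Abstraction abs

  -- Truth is transported along a preimage among the atoms of `φ`, where the abstraction is known to
  -- be injective.
  Trueᴮ : I → Literal 𝒳 → Set
  Trueᴮ i m = ∃ λ l → atom l ∈Atoms φ × HoldsLiteral (Holds i) l × m ≡ mapLiteral _ᴮ l

  -- 𝒳 has no decidable equality, so a resolution step can only be shown to
  -- preserve truth up to double negation.
  Satᴮ : I → Clause 𝒳 → Set
  Satᴮ i C = ¬ ¬ (∃ λ m → m ∈ C × Trueᴮ i m)

  trueᴮ-consistent : ∀ {i} m → Trueᴮ i m → ¬ Trueᴮ i (~ m)
  trueᴮ-consistent _ (pos a , a∈ , ha , refl) (neg b , b∈ , hb , eq) =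
    hb (resp (injective a∈ b∈ (cong atom eq)) ha)
  trueᴮ-consistent _ (neg a , a∈ , ha , refl) (pos b , b∈ , hb , eq) =
    ha (resp (injective b∈ a∈ (cong atom (sym eq))) hb)

  clauseᴮ-sat : ∀ {i L} → All (λ l → atom l ∈Atoms φ) L →
                Any (HoldsLiteral (Holds i)) L → Satᴮ i (clauseᴮ L)
  clauseᴮ-sat L⊆ anyL ¬sat with find anyL
  ... | l , l∈L , hl = ¬sat (_ , ∈-map⁺ _ l∈L , l , All.lookup L⊆ l∈L , hl , refl)

  resolvent-sat : ∀ {i l C D E} → Resolvent l C D E → Satᴮ i C → Satᴮ i D → Satᴮ i E
  resolvent-sat {i} {l} R satC satD ¬E =
    satC λ (m , m∈C , tm) → satD λ (n , n∈D , tn) →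
    -- The witness `m` is offered first and must differ from `l`. If it equals `l`, the witness `n`
    -- is offered instead, and `n ≡ ~ l` then contradicts consistency.
    ¬E (m , Equivalence.from members (inj₁ (m∈C , λ m≡l →
    ¬E (n , Equivalence.from members (inj₂ (n∈D , λ n≡~l →
      trueᴮ-consistent l (subst (Trueᴮ i) m≡l tm) (subst (Trueᴮ i) n≡~l tn)))
      , tn))) , tm)
    where open Resolvent R

  sat-resp-set : ∀ {i C D} → D ∼[ set ] C → Satᴮ i C → Satᴮ i D
  sat-resp-set D∼C satC ¬D = satC λ (m , m∈C , tm) → ¬D (m , Equivalence.from D∼C m∈C , tm)

  literals∈Atoms : ∀ {L} → L ∈ φ → All (λ l → atom l ∈Atoms φ) L
  literals∈Atoms L∈φ =
    All.tabulate λ l∈L → lose L∈φ (Any.map (λ { refl → same }) l∈L)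

  -- Induction on the derivation with the list of candidates varying: resolution costs no candidate
  -- and a learned clause at most one, so with more candidates than learning steps one of them
  -- satisfies every clause derived so far.
  survivor : ∀ {Γ} (δ : Derivation 𝒯 φ abs Γ) {is} → Unique is →
             learnSteps 𝒯 φ abs δ < length is →
             ∃ λ i → i ∈ is × All (Satᴮ i) Γ
  survivor start {i ∷ is} _ _ =
    i , here refl ,
    All.map⁺ (All.tabulate λ L∈φ →
      clauseᴮ-sat (literals∈Atoms L∈φ) (All.lookup (models i) L∈φ))
  survivor (res {Γ} δ j k _ l R) is! few with survivor δ is! few
  ... | i , i∈is , sat =
    i , i∈is , All.∷ʳ⁺ sat
      (resolvent-sat R (All.lookup sat (∈-lookup j)) (All.lookup sat (∈-lookup k)))
  survivor (learn δ L L⊆ ⊨L E∼L) is! few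
    with dropFailure (λ i → Any.any? (holdsLiteral? (holds? i)) L)
                     (λ i≢j → separated i≢j L⊆ ⊨L) is!
  ... | js , ∣is∣≤ , js! , holdsL , js⊆is
    with survivor δ js! (s<s⁻¹ (ℕ.<-≤-trans few ∣is∣≤))
  ... | j , j∈js , sat =
    j , All.lookup js⊆is j∈js , All.∷ʳ⁺ sat
      (sat-resp-set E∼L (clauseᴮ-sat L⊆ (All.lookup holdsL j∈js)))

  length≤#learn : (π : UnsatProof 𝒯 φ abs) → ∀ {is} → Unique is →
                  length is ≤ #learn 𝒯 φ abs π
  -- A survivor would have to satisfy the final empty clause.
  length≤#learn (Γ , δ) is! = ℕ.≮⇒≥ λ few →
    proj₂ (All.∷ʳ⁻ (proj₂ (proj₂ (survivor δ is! few)))) λ ()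

-- Strictly ascending chains in a total order.

module _ {a r} {A : Set a} {R : Rel A r} where

  lookup-AllPairs : ∀ {xs} → AllPairs R xs →
                    ∀ {i j} → i Fin.< j → R (lookup xs i) (lookup xs j)
  lookup-AllPairs (Rx ∷ _)   {zero}  {suc j} _         = All.lookup Rx (∈-lookup j)
  lookup-AllPairs (_  ∷ Rxs) {suc i} {suc j} (s≤s i<j) = lookup-AllPairs Rxs i<j

module _ {a ℓ₁ ℓ₂} (O : StrictTotalOrder a ℓ₁ ℓ₂) where
  private module O = StrictTotalOrder O
  open StrictTotalOrderProperties O using (decTotalOrder; module Eq) renaming (trans to ≤-trans)
  open Sorting decTotalOrder

  -- Sorting the image of the injection gives a weakly ascending list of the same length; its
  -- entries are pairwise distinct, so it ascends strictly.
  ascending : ∀ {n} → Injection (setoid (Fin n)) O.Eq.setoid →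
              ∃ λ (f : Fin n → O.Carrier) → ∀ {i j} → i Fin.< j → f i O.< f j
  ascending {n} ι = lookup ys ∘ cast (sym ∣ys∣≡n) , λ {i} {j} i<j →
    lookup-AllPairs ys↗ (subst₂ _<_ (sym (Fin.toℕ-cast _ i)) (sym (Fin.toℕ-cast _ j)) i<j)
    where
    open Injection ι using (to; injective)
    xs = tabulate to
    ys = sort xs

    ∣ys∣≡n : length ys ≡ n
    ∣ys∣≡n = trans (↭.↭-length (sort-↭ xs)) (length-tabulate to)

    strict : ∀ {x y} → (x O.< y ⊎ x O.≈ y) × ¬ x O.≈ y → x O.< y
    strict (inj₁ x<y , _)   = x<y
    strict (inj₂ x≈y , x≉y) = contradiction x≈y x≉y

    ys! : AllPairs (λ x y → ¬ x O.≈ y) ys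
    ys! = Unique-resp-↭ Eq.setoid (↭-sym Eq.setoid (SortingAlgorithm.sort-↭ₛ sortingAlgorithm xs))
      (AllPairs.tabulate⁺ λ i≢j → i≢j ∘ injective)

    ys↗ : AllPairs O._<_ ys
    ys↗ = AllPairs.zipWith strict (Linked⇒AllPairs ≤-trans (sort-↗ xs) , ys!)

-- Enumeration of permutations.

-- Factorial-base numbering: the leading digit `j` is the image of `zero`, the remaining digits
-- number a permutation of the other elements.
permutation : ∀ n → Fin (n !) → Permutation′ n
permutation zero    _ = id
permutation (suc n) k = let j , k′ = remQuot {suc n} (n !) k in
  insert zero j (permutation n k′)

insert-zero-injective : ∀ {n i j} {π ρ : Permutation′ n} →
  insert zero i π ≈ insert zero j ρ → i ≡ j × π ≈ ρ
insert-zero-injective {i = i} {π = π} {ρ} eq with eq zero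
... | refl = refl , λ k → Fin.punchIn-injective i _ _
  (trans (sym (insert-punchIn zero i π k)) (trans (eq (suc k)) (insert-punchIn zero i ρ k)))

permutation-injective : ∀ n {k l} → permutation n k ≈ permutation n l → k ≡ l
permutation-injective zero    {zero} {zero} _ = refl
permutation-injective (suc n) {k} {l} eq = begin
  k                                              ≡⟨ Fin.combine-remQuot {suc n} (n !) k ⟨
  uncurry combine (remQuot {suc n} (n !) k)      ≡⟨ cong₂ combine i≡j (permutation-injective n π≈ρ) ⟩
  uncurry combine (remQuot {suc n} (n !) l)      ≡⟨ Fin.combine-remQuot {suc n} (n !) l ⟩
  l                                              ∎
  where
  open ≡-Reasoning
  i≡j = proj₁ (insert-zero-injective eq)
  π≈ρ = proj₂ (insert-zero-injective eq)

-- Numerals in the value theories.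

-- Injectivity is bounded because bit-vectors wrap around; the successor law survives wrapping.
record Counting (V : ValueStructure) (n : ℕ) : Set where
  private module V = ValueStructure V
  field
    numeral-suc       : ∀ i → (V.numeral i V.+ V.numeral 1) V.≈ V.numeral (suc i)
    numeral-injective : ∀ {i j} → i ≤ suc n → j ≤ suc n → V.numeral i V.≈ V.numeral j → i ≡ j
    numeral-<         : V.numeral n V.< V.numeral (suc n)

toℕ-bv : ∀ k n → toℕ (bv k n) ≡ _%_ n (2 ^ k) {{ℕ.m^n≢0 2 k}}
toℕ-bv k n = Fin.toℕ-fromℕ< (m%n<n n (2 ^ k) {{ℕ.m^n≢0 2 k}})

bv-+ : ∀ k m n → bv k (toℕ (bv k m) + toℕ (bv k n)) ≡ bv k (m + n)
bv-+ k m n = Fin.toℕ-injective (begin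
  toℕ (bv k (toℕ (bv k m) + toℕ (bv k n))) ≡⟨ toℕ-bv k _ ⟩
  (toℕ (bv k m) + toℕ (bv k n)) % 2 ^ k    ≡⟨ cong₂ (λ a b → (a + b) % 2 ^ k) (toℕ-bv k m) (toℕ-bv k n) ⟩
  (m % 2 ^ k + n % 2 ^ k) % 2 ^ k          ≡⟨ %-distribˡ-+ m n (2 ^ k) ⟨
  (m + n) % 2 ^ k                          ≡⟨ toℕ-bv k _ ⟨
  toℕ (bv k (m + n))                       ∎)
  where
  open ≡-Reasoning
  instance _ = ℕ.m^n≢0 2 k

toℚᵘ-numeral : ∀ n → toℚᵘ (+ n ℚ./ 1) ℚᵘ.≃ mkℚᵘ (+ n) 0
toℚᵘ-numeral n = ℚ.toℚᵘ-fromℚᵘ (mkℚᵘ (+ n) 0)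

numeralℚ-suc : ∀ n → (+ n ℚ./ 1) ℚ.+ 1ℚ ≡ + suc n ℚ./ 1
numeralℚ-suc n = ℚ.toℚᵘ-injective (begin
  toℚᵘ ((+ n ℚ./ 1) ℚ.+ 1ℚ)       ≈⟨ ℚ.toℚᵘ-homo-+ (+ n ℚ./ 1) 1ℚ ⟩
  toℚᵘ (+ n ℚ./ 1) ℚᵘ.+ ℚᵘ.1ℚᵘ    ≈⟨ ℚᵘ.+-congˡ ℚᵘ.1ℚᵘ (toℚᵘ-numeral n) ⟩
  mkℚᵘ (+ n) 0 ℚᵘ.+ ℚᵘ.1ℚᵘ        ≈⟨ *≡* (cong (ℤ._* + 1) n*1+1≡1+n) ⟩
  mkℚᵘ (+ suc n) 0                ≈⟨ toℚᵘ-numeral (suc n) ⟨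
  toℚᵘ (+ suc n ℚ./ 1)            ∎)
  where
  open ℚᵘ.≃-Reasoning
  n*1+1≡1+n : + n ℤ.* + 1 ℤ.+ + 1 ≡ + suc n
  n*1+1≡1+n = trans (cong (ℤ._+ + 1) (ℤ.*-identityʳ (+ n))) (cong +_ (ℕ.+-comm n 1))

numeralℚ-injective : ∀ {m n} → + m ℚ./ 1 ≡ + n ℚ./ 1 → m ≡ n
numeralℚ-injective {m} {n} eq with ℚ./-injective-≃ (mkℚᵘ (+ m) 0) (mkℚᵘ (+ n) 0) eq
... | *≡* m*1≡n*1 = ℤ.+-injective (ℤ.*-cancelʳ-≡ (+ m) (+ n) (+ 1) m*1≡n*1)

fromℚ-cong : ∀ {p q} → p ≡ q → fromℚ p ≈ℝ fromℚ q
fromℚ-cong {p} refl {ε} = IsEquivalence.refl ≈ℝ-isEquivalence {x = fromℚ p} {ε}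

-- For `p` and `q` distinct, the tolerance `∣ p - q ∣` is positive and would have to be smaller than
-- itself.
fromℚ-injective : ∀ {p q} → fromℚ p ≈ℝ fromℚ q → p ≡ q
fromℚ-injective {p} {q} p≈q with p ℚ.≟ q
... | yes p≡q = p≡q
... | no  p≢q = contradiction (proj₂ (p≈q 0<∣p-q∣) {proj₁ (p≈q 0<∣p-q∣)} ℕ.≤-refl) (ℚ.<-irrefl refl)
  where
  0<∣p-q∣ : 0ℚ ℚ.< ∣ p ℚ.- q ∣
  0<∣p-q∣ = ℚ.≰⇒> λ ∣p-q∣≤0 → p≢q (Group.x∙y⁻¹≈ε⇒x≈y ℚ.+-0-group p q
    (ℚ.∣p∣≡0⇒p≡0 (p ℚ.- q) (ℚ.≤-antisym ∣p-q∣≤0 (ℚ.0≤∣p∣ (p ℚ.- q)))))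

counting : ∀ 𝒱 n → Representable 𝒱 (suc n) → Counting (valueStructure 𝒱) n
counting (bitVector ± k) n rep = record
  { numeral-suc       = λ i → trans (bv-+ k i 1) (cong (bv k) (ℕ.+-comm i 1))
  ; numeral-injective = λ {i} {j} i≤ j≤ eq → ℤ.+-injective
      (trans (sym (rep i≤)) (trans (cong (bvToℤ ± k) eq) (rep j≤)))
  ; numeral-<         = subst₂ ℤ._<_ (sym (rep (ℕ.n≤1+n n))) (sym (rep ℕ.≤-refl)) (+<+ (ℕ.n<1+n n))
  }
counting presburgerℕ n _ = record
  { numeral-suc       = λ i → ℕ.+-comm i 1
  ; numeral-injective = λ _ _ eq → eq
  ; numeral-<         = ℕ.n<1+n n
  }
counting presburgerℤ n _ = record
  { numeral-suc       = λ i → cong +_ (ℕ.+-comm i 1)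
  ; numeral-injective = λ _ _ → ℤ.+-injective
  ; numeral-<         = +<+ (ℕ.n<1+n n)
  }
counting real n _ = record
  { numeral-suc       = λ i {_} → fromℚ-cong (numeralℚ-suc i)
  ; numeral-injective = λ _ _ eq → numeralℚ-injective (fromℚ-injective (λ {ε} → eq {ε}))
  -- Any gap strictly between 0 and 1 separates consecutive numerals; ½ is taken.
  ; numeral-<         = ½ , ℚ.positive⁻¹ ½ , 0 , λ _ → subst ((+ n ℚ./ 1) ℚ.+ ½ ℚ.<_) (numeralℚ-suc n)
      (ℚ.+-monoʳ-< (+ n ℚ./ 1) (ℚ.*<* (+<+ (ℕ.n<1+n 1))))
  }

-- Case analysis over the clauses of the encoding.

forAll⁺ : ∀ {a b p} {A : Set a} {B : Set b} {P : B → Set p} {f : A → List B} {xs} →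
          All (λ x → All P (f x)) xs → All P (forAll xs f)
forAll⁺ = All.concat⁺ ∘ All.map⁺

unorderedPairs⁺ : ∀ {a r} {A : Set a} {R : A → A → Set r} {xs} → AllPairs R xs →
                  All (λ (x , y) → R x y) (unorderedPairs xs)
unorderedPairs⁺ []         = []
unorderedPairs⁺ (Rx ∷ Rxs) = All.++⁺ (All.map⁺ Rx) (unorderedPairs⁺ Rxs)

writes-unique : ∀ N → Unique (writes N)
writes-unique N =
  All.map⁺ (All.universal (λ _ ()) (allFin N)) ∷ Unique.map⁺ (λ { refl → refl }) (Unique.allFin⁺ N)

∈-writes : ∀ {N} x → x ∈ writes N
∈-writes wInit = here refl
∈-writes (w i) = there (∈-map⁺ w (∈-allFin i))

-- Merges the value clauses of the initial write and those of the threads into one family.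
sourceValue : ∀ {N} → Write N → Term N val
sourceValue wInit = num 0
sourceValue (w i) = rv (r i) ∔ num 1

-- Serves twice: to show that each execution satisfies the clauses, and to follow their atoms into
-- the separating assignment.
φ²-elim : ∀ {N p} {P : Clause (Atom N) → Set p} →
  (∀ y → P (fact (c (wr wInit) ≺ c (rd y)))) →
  (∀ i → P (fact (c (rd (r i)) ≺ c (wr (w i))))) →
  (∀ {x x′} → x ≢ x′ → P (notEqual (c (wr x)) (c (wr x′)))) →
  (∀ {x x′} → x ≢ x′ → P (notEqual (s (wr x)) (s (wr x′)))) →
  (∀ x y → P (notEqual (c (wr x)) (c (rd y)))) →
  (∀ x y → P (s (wr x) ≐ s (rd y) ⇒ c (wr x) ≐ sup y)) →
  (∀ x y → P (s (wr x) ≐ s (rd y) ⇒ c (wr x) ≺ c (rd y))) →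
  (∀ x y → P (c (wr x) ⪯ c (rd y) ⇒ c (wr x) ⪯ sup y)) →
  (∀ x y → P (s (wr x) ≐ s (rd y) ⇒ sourceValue x ≐ rv y)) →
  (∀ y → P (map (λ x → pos (s (wr x) ≐ s (rd y))) (writes N))) →
  P (fact (rv rAssert ≻ num N)) →
  All P (φ² N)
φ²-elim {N} p₁ p₂ p₃ p₄ p₅ p₆ p₇ p₈ p₉ p₁₀ p₁₁ =
  p₁ rAssert ∷
  All.++⁺ (forAll⁺ $ All.universal (λ i → p₁ (r i) ∷ p₂ i ∷ []) (allFin N))
  (All.++⁺ (forAll⁺ $ All.map (λ x≢x′ → p₃ x≢x′ ∷ p₄ x≢x′ ∷ []) (unorderedPairs⁺ (writes-unique N)))
  (All.++⁺ (forAll⁺ $ All.universal (λ x →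
              forAll⁺ $ All.universal (λ y → p₅ x y ∷ p₆ x y ∷ p₇ x y ∷ p₈ x y ∷ []) (reads N))
              (writes N))
  (All.++⁺ (forAll⁺ $ All.universal (λ y →
              p₉ wInit y ∷ (forAll⁺ $ All.universal (λ i → p₉ (w i) y ∷ []) (allFin N)))
              (reads N))
  (All.++⁺ (forAll⁺ $ All.universal (λ y → p₁₀ y ∷ []) (reads N))
  (p₁₁ ∷ [])))))

-- Sequential executions.

2*m≤1+2*n⇒2*m≤2*n : ∀ m n → 2 * m ≤ suc (2 * n) → 2 * m ≤ 2 * n
2*m≤1+2*n⇒2*m≤2*n m n 2m≤1+2n = s≤s⁻¹ (ℕ.≤∧≢⇒< 2m≤1+2n (ℕ.even≢odd m n))

module _ {N} (π : Permutation′ N) where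

  -- In the sequential execution in which thread i is the (π i)-th to run, a read
  -- reads from the write at the same stage, and the value read is its stage.
  stage : Event N → Fin (suc N)
  stage (rd (r i))   = inject₁ (π ⟨$⟩ʳ i)
  stage (rd rAssert) = fromℕ N
  stage (wr wInit)   = zero
  stage (wr (w i))   = suc (π ⟨$⟩ʳ i)

  stage-wr-surjective : ∀ k → ∃ λ x → stage (wr x) ≡ k
  stage-wr-surjective zero    = wInit , refl
  stage-wr-surjective (suc k) = w (π ⟨$⟩ˡ k) , cong suc (inverseʳ π)

  stage-wr-injective : ∀ {x x′} → stage (wr x) ≡ stage (wr x′) → x ≡ x′
  stage-wr-injective {wInit} {wInit} _  = refl
  stage-wr-injective {w i}   {w j}   eq =
    cong w (Injection.injective (↔⇒↣ π) (Fin.suc-injective eq))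

  stage-rd-injective : ∀ {y y′} → stage (rd y) ≡ stage (rd y′) → y ≡ y′
  stage-rd-injective {r i}     {r j}     eq =
    cong r (Injection.injective (↔⇒↣ π) (Fin.inject₁-injective eq))
  stage-rd-injective {r i}     {rAssert} eq = contradiction (sym eq) Fin.fromℕ≢inject₁
  stage-rd-injective {rAssert} {r j}     eq = contradiction eq Fin.fromℕ≢inject₁
  stage-rd-injective {rAssert} {rAssert} _  = refl

  -- A stage consists of a write followed by the reads from it.
  eval : ∀ {σ} → Term N σ → ℕ
  eval (c (rd y)) = suc (2 * toℕ (stage (rd y)))
  eval (c (wr x)) = 2 * toℕ (stage (wr x))
  eval (sup y)    = 2 * toℕ (stage (rd y))
  eval (s e)      = toℕ (stage e)
  eval (rv y)     = toℕ (stage (rd y))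
  eval (num n)    = n
  eval (t ∔ u)    = eval t + eval u

  -- The only atom of φ² of the form t ≻ u is the assertion, declared true.
  Holds : Atom N → Set
  Holds (t ≐ u) = eval t ≡ eval u
  Holds (t ≺ u) = eval t < eval u
  Holds (t ⪯ u) = eval t ≤ eval u
  Holds (t ≻ u) = ⊤

  holds? : ∀ a → Dec (Holds a)
  holds? (t ≐ u) = eval t ℕ.≟ eval u
  holds? (t ≺ u) = eval t ℕ.<? eval u
  holds? (t ⪯ u) = eval t ℕ.≤? eval u
  holds? (t ≻ u) = yes tt

  holds-resp-≅ : ∀ {a b} → a ≅ b → Holds a → Holds b
  holds-resp-≅ same eq = eq
  holds-resp-≅ swap eq = sym eq

  -- A thread reads the number of its stage, adds one, and writes in the next stage.
  eval-sourceValue : ∀ x → eval (sourceValue x) ≡ eval (s (wr x))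
  eval-sourceValue wInit = refl
  eval-sourceValue (w i) =
    trans (ℕ.+-comm (eval (rv (r i))) 1) (cong suc (Fin.toℕ-inject₁ (π ⟨$⟩ʳ i)))

  clock-wr-distinct : ∀ {x x′} → x ≢ x′ → eval (c (wr x)) ≢ eval (c (wr x′))
  clock-wr-distinct x≢x′ = x≢x′ ∘ stage-wr-injective ∘ Fin.toℕ-injective ∘ ℕ.*-cancelˡ-≡ _ _ 2

  ⇒-holds : ∀ {a b} → (Holds a → Holds b) → Any (HoldsLiteral Holds) (a ⇒ b)
  ⇒-holds {a} f with holds? a
  ... | yes ha = there (here (f ha))
  ... | no ¬ha = here ¬ha

  -- Write clocks are even and read clocks odd, so parity keeps them apart and lowers a bound on a
  -- write from a read to its `sup`. A true selection atom equates two stages, hence also the `sup`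
  -- and the value. Every stage has a write, so every read has a source.
  holds-φ² : All (Any (HoldsLiteral Holds)) (φ² N)
  holds-φ² = φ²-elim
    (λ _ → here z<s)
    (λ i → here (ℕ.≤-reflexive
      (trans (cong (λ k → 2 + 2 * k) (Fin.toℕ-inject₁ (π ⟨$⟩ʳ i))) (sym (ℕ.*-suc 2 _)))))
    (λ x≢x′ → here (clock-wr-distinct x≢x′))
    (λ x≢x′ → here (x≢x′ ∘ stage-wr-injective ∘ Fin.toℕ-injective))
    (λ x y → here (ℕ.even≢odd (toℕ (stage (wr x))) (toℕ (stage (rd y)))))
    (λ x y → ⇒-holds (cong (2 *_)))
    (λ x y → ⇒-holds λ eq → s≤s (ℕ.≤-reflexive (cong (2 *_) eq)))
    (λ x y → ⇒-holds (2*m≤1+2*n⇒2*m≤2*n (toℕ (stage (wr x))) (toℕ (stage (rd y)))))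
    (λ x y → ⇒-holds (trans (eval-sourceValue x)))
    (λ y → let x , x-y = stage-wr-surjective (stage (rd y)) in
      Any.map (λ { refl → cong toℕ x-y }) (∈-map⁺ _ (∈-writes x)))
    (here tt)

  -- There are `N + 1` stages with two clock values each.
  eval-clk-< : ∀ (t : Term N clk) → eval t < 2 * N + 2
  eval-clk-< t = ℕ.≤-trans (s≤s (bound t)) (ℕ.≤-reflexive (ℕ.+-comm 2 (2 * N)))
    where
    2*stage≤ : ∀ e → 2 * toℕ (stage e) ≤ 2 * N
    2*stage≤ e = ℕ.*-monoʳ-≤ 2 (Fin.toℕ≤pred[n] (stage e))

    bound : ∀ (t : Term N clk) → eval t ≤ suc (2 * N)
    bound (c (rd y)) = s≤s (2*stage≤ (rd y))
    bound (c (wr x)) = ℕ.m≤n⇒m≤1+n (2*stage≤ (wr x))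
    bound (sup y)    = ℕ.m≤n⇒m≤1+n (2*stage≤ (rd y))

-- Separating two executions.

-- `punchIn` on ℕ: renumbering that leaves out the value k.
shift : ℕ → ℕ → ℕ
shift zero    n       = suc n
shift (suc k) zero    = zero
shift (suc k) (suc n) = suc (shift k n)

shift-≤ : ∀ k n → shift k n ≤ suc n
shift-≤ zero    n       = ℕ.≤-refl
shift-≤ (suc k) zero    = z≤n
shift-≤ (suc k) (suc n) = s≤s (shift-≤ k n)

shift-≥ : ∀ {k n} → k ≤ n → shift k n ≡ suc n
shift-≥ z≤n       = refl
shift-≥ (s≤s k≤n) = cong suc (shift-≥ k≤n)

-- Moving the gap from `k` to `suc k` changes the image of `k` alone; this confines the damage to
-- one reads-from edge.
shift-suc : ∀ {k n} → n ≢ k → shift (suc k) n ≡ shift k n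
shift-suc {zero}  {zero}  n≢k = contradiction refl n≢k
shift-suc {zero}  {suc n} _   = refl
shift-suc {suc k} {zero}  _   = refl
shift-suc {suc k} {suc n} n≢k = cong suc (shift-suc (n≢k ∘ cong suc))

-- At `m ≡ k` the left side is `k`, the value that `shift k` omits; elsewhere the two shifts agree,
-- and `shift k` is injective.
shift-suc-cancel : ∀ {k m n} → shift (suc k) m ≡ shift k n → m ≡ n
shift-suc-cancel {zero}  {suc m} {n}     refl = refl
shift-suc-cancel {suc k} {zero}  {zero}  _    = refl
shift-suc-cancel {suc k} {suc m} {suc n} eq   = cong suc (shift-suc-cancel (ℕ.suc-injective eq))

module Separation {ℓ} {𝒯 : Theory ℓ} {N} (M : Model 𝒯)
  (clocks : AtLeast (2 * N + 2) (StrictTotalOrder.Eq.setoid (Model.clock M)))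
  (selections : AtLeast (suc N) (Model.selection M))
  (values : Counting (Theory.value 𝒯) N)
  (π ρ : Permutation′ N) (x₀ : Write N) (y₀ : Read N)
  (x₀-y₀ : stage π (wr x₀) ≡ stage π (rd y₀))
  (x₀≁y₀ : stage ρ (wr x₀) ≢ stage ρ (rd y₀))
  where

  open Semantics M N
  open Model M
  open Counting values
  private
    module C = StrictTotalOrder clock
    module S = Setoid selection
    module V = ValueStructure (Theory.value 𝒯)
    module V≈ = IsEquivalence V.isEquivalence
    open Injection selections using ()
      renaming (to to pick; injective to pick-injective; cong to pick-cong)

  k : ℕ
  k = toℕ (stage π (rd y₀))

  chain : Fin (2 * N + 2) → C.Carrier
  chain = proj₁ (ascending clock clocks)

  chain-mono : ∀ {i j} → i Fin.< j → chain i C.< chain j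
  chain-mono = proj₂ (ascending clock clocks)

  chain-cancel-< : ∀ {i j} → chain i C.< chain j → i Fin.< j
  chain-cancel-< {i} {j} fi<fj with Fin.<-cmp i j
  ... | tri< i<j _ _    = i<j
  ... | tri≈ _ refl _   = contradiction fi<fj (C.irrefl C.Eq.refl)
  ... | tri> _ _ j<i    = contradiction fi<fj (C.asym (chain-mono j<i))

  chain-injective : ∀ {i j} → chain i C.≈ chain j → i ≡ j
  chain-injective {i} {j} fi≈fj with Fin.<-cmp i j
  ... | tri< i<j _ _ = contradiction (chain-mono i<j) (C.irrefl fi≈fj)
  ... | tri≈ _ i≡j _ = i≡j
  ... | tri> _ _ j<i = contradiction (chain-mono j<i) (C.irrefl (C.Eq.sym fi≈fj))

  tick : Term N clk → Fin (2 * N + 2)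
  tick t = fromℕ< (eval-clk-< π t)

  toℕ-tick : ∀ t → toℕ (tick t) ≡ eval π t
  toℕ-tick t = Fin.toℕ-fromℕ< (eval-clk-< π t)

  β : Assignment
  β = record
    { cᵃ   = λ e → chain (tick (c e))
    ; supᵃ = λ y → chain (tick (sup y))
    ; sᵃ   = λ e → pick (stage π e)
    ; rvᵃ  = λ y → V.numeral (shift k (eval π (rv y)))
    }

  ⟦clk⟧ : ∀ t → ⟦ β ⟧ᵗ t ≡ chain (tick t)
  ⟦clk⟧ (c e)   = refl
  ⟦clk⟧ (sup y) = refl

  -- Exactly what carries falsity of a clause over to `β`: a positive literal is false under `π`,
  -- and the atom of a negative one is true under both `π` and `ρ`.
  record Follows (a : Atom N) : Set where
    constructor _,_
    field
      preserved : Holds π a → Holds ρ a → ⟦ β ⟧ᵃ a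
      reflected : ⟦ β ⟧ᵃ a → Holds π a

  open Follows

  Reflected : Atom N → Set
  Reflected a = Holds π a ⇔ ⟦ β ⟧ᵃ a

  reflected⇒follows : ∀ {a} → Reflected a → Follows a
  reflected⇒follows a⇔ = (λ πa _ → Equivalence.to a⇔ πa) , Equivalence.from a⇔

  reflected-clk-≐ : ∀ {t u : Term N clk} → Reflected (t ≐ u)
  reflected-clk-≐ {t} {u} rewrite ⟦clk⟧ t | ⟦clk⟧ u = mk⇔
    (λ t≡u → C.Eq.reflexive (cong chain (Fin.toℕ-injective
      (trans (toℕ-tick t) (trans t≡u (sym (toℕ-tick u)))))))
    (λ t≈u → trans (sym (toℕ-tick t)) (trans (cong toℕ (chain-injective t≈u)) (toℕ-tick u)))

  reflected-≺ : ∀ {t u} → Reflected (t ≺ u)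
  reflected-≺ {t} {u} rewrite ⟦clk⟧ t | ⟦clk⟧ u = mk⇔
    (λ t<u → chain-mono (subst₂ _<_ (sym (toℕ-tick t)) (sym (toℕ-tick u)) t<u))
    (λ t<u → subst₂ _<_ (toℕ-tick t) (toℕ-tick u) (chain-cancel-< t<u))

  reflected-⪯ : ∀ {t u} → Reflected (t ⪯ u)
  reflected-⪯ {t} {u} = mk⇔
    (Sum.map (Equivalence.to (reflected-≺ {t} {u})) (Equivalence.to (reflected-clk-≐ {t} {u}))
      ∘ ℕ.m≤n⇒m<n∨m≡n)
    Sum.[ ℕ.<⇒≤ ∘ Equivalence.from (reflected-≺ {t} {u})
        , ℕ.≤-reflexive ∘ Equivalence.from (reflected-clk-≐ {t} {u}) ]

  follows-clk-≐ : ∀ {t u : Term N clk} → Follows (t ≐ u)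
  follows-clk-≐ {t} {u} = reflected⇒follows {t ≐ u} (reflected-clk-≐ {t} {u})

  follows-≺ : ∀ {t u} → Follows (t ≺ u)
  follows-≺ {t} {u} = reflected⇒follows {t ≺ u} (reflected-≺ {t} {u})

  follows-⪯ : ∀ {t u} → Follows (t ⪯ u)
  follows-⪯ {t} {u} = reflected⇒follows {t ⪯ u} (reflected-⪯ {t} {u})

  follows-sel-≐ : ∀ {t u : Term N sel} → Follows (t ≐ u)
  follows-sel-≐ {s e} {s e′} =
    (λ eq _ → pick-cong (Fin.toℕ-injective eq)) , λ eq → cong toℕ (pick-injective eq)

  stage-≤ : ∀ e → toℕ (stage π e) ≤ N
  stage-≤ e = Fin.toℕ≤pred[n] (stage π e)

  -- The successor of `shift k j` is `shift (suc k) (suc j)` by definition, so the written values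
  -- have their gap one higher than the read ones.
  ⟦sourceValue⟧ : ∀ x → ⟦ β ⟧ᵗ (sourceValue x) V.≈ V.numeral (shift (suc k) (eval π (s (wr x))))
  ⟦sourceValue⟧ wInit = V≈.refl
  ⟦sourceValue⟧ (w i) rewrite Fin.toℕ-inject₁ (π ⟨$⟩ʳ i) =
    numeral-suc (shift k (toℕ (π ⟨$⟩ʳ i)))

  follows-sourceValue : ∀ x y → Follows (sourceValue x ≐ rv y)
  follows-sourceValue x y =
      (λ x-yπ x-yρ → V≈.trans (⟦sourceValue⟧ x) (V≈.reflexive (cong V.numeral
        (trans (shift-suc (x≢k x-yπ x-yρ))
               (cong (shift k) (trans (sym (eval-sourceValue π x)) x-yπ))))))
    -- Stages are at most `N`, so shifted values stay within `N + 1`, where numerals are injective.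
    , λ eq → trans (eval-sourceValue π x) (shift-suc-cancel (numeral-injective
        (ℕ.≤-trans (shift-≤ (suc k) _) (s≤s (stage-≤ (wr x))))
        (ℕ.≤-trans (shift-≤ k _) (s≤s (stage-≤ (rd y))))
        (V≈.trans (V≈.sym (⟦sourceValue⟧ x)) eq)))
    where
    -- At stage `k` of `π` the edge could only be the one from `x₀` to `y₀`, which is absent in `ρ`.
    x≢k : Holds π (sourceValue x ≐ rv y) → Holds ρ (sourceValue x ≐ rv y) →
          eval π (s (wr x)) ≢ k
    x≢k x-yπ x-yρ x≡k
      with stage-wr-injective π {x} {x₀} (trans (Fin.toℕ-injective x≡k) (sym x₀-y₀))
         | stage-rd-injective π {y} {y₀}
             (Fin.toℕ-injective (trans (sym x-yπ) (trans (eval-sourceValue π x) x≡k)))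
    ... | refl | refl = x₀≁y₀ (Fin.toℕ-injective (trans (sym (eval-sourceValue ρ x)) x-yρ))

  follows-φ² : All (All (Follows ∘ atom)) (φ² N)
  follows-φ² = φ²-elim
    (λ _ → follows-≺ ∷ [])
    (λ _ → follows-≺ ∷ [])
    (λ _ → follows-clk-≐ ∷ [])
    (λ _ → follows-sel-≐ ∷ [])
    (λ _ _ → follows-clk-≐ ∷ [])
    (λ _ _ → follows-sel-≐ ∷ follows-clk-≐ ∷ [])
    (λ _ _ → follows-sel-≐ ∷ follows-≺ ∷ [])
    (λ _ _ → follows-⪯ ∷ follows-⪯ ∷ [])
    (λ x y → follows-sel-≐ ∷ follows-sourceValue x y ∷ [])
    (λ _ → All.map⁺ (All.universal (λ _ → follows-sel-≐) (writes N)))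
    (((λ _ _ → assertion) , λ _ → tt) ∷ [])
    where
    -- The asserting read is at the last stage `N`, which is at least `k`, so its value is raised to
    -- `N + 1`.
    assertion : V.numeral N V.< V.numeral (shift k (toℕ (fromℕ N)))
    assertion rewrite Fin.toℕ-fromℕ N | shift-≥ (stage-≤ (rd y₀)) = numeral-<

  follows-resp-≅ : ∀ {a b} → a ≅ b → Follows a → Follows b
  follows-resp-≅ same f = f
  follows-resp-≅ (swap {clk}) (⁺ , ⁻) = (λ p q → C.Eq.sym (⁺ (sym p) (sym q))) , sym ∘ ⁻ ∘ C.Eq.sym
  follows-resp-≅ (swap {val}) (⁺ , ⁻) = (λ p q → V≈.sym (⁺ (sym p) (sym q))) , λ eq → sym (⁻ (V≈.sym eq))
  follows-resp-≅ (swap {sel}) (⁺ , ⁻) = (λ p q → S.sym (⁺ (sym p) (sym q))) , sym ∘ ⁻ ∘ S.sym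

  follows : ∀ {a} → a ∈Atoms φ² N → Follows a
  follows a∈ with find a∈
  ... | _ , L∈ , a∈L with find a∈L
  ... | _ , l∈ , l≅a = follows-resp-≅ l≅a (All.lookup (All.lookup follows-φ² L∈) l∈)

  falsified : ∀ {L} → All (λ l → atom l ∈Atoms φ² N) L →
              ¬ Any (HoldsLiteral (Holds π)) L → ¬ Any (HoldsLiteral (Holds ρ)) L →
              ¬ Any (⟦ β ⟧ˡ) L
  falsified (a∈ ∷ _) ¬π _ (here {pos a} ⟦a⟧)  = ¬π (here (reflected (follows a∈) ⟦a⟧))
  falsified (a∈ ∷ _) ¬π ¬ρ (here {neg a} ¬⟦a⟧) =
    ¬π (here λ πa → ¬ρ (here λ ρa → ¬⟦a⟧ (preserved (follows a∈) πa ρa)))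
  falsified (_ ∷ L⊆) ¬π ¬ρ (there ⟦L⟧) = falsified L⊆ (¬π ∘ there) (¬ρ ∘ there) ⟦L⟧

-- Reads-from edges and the final count.

-- Each thread reads from its predecessor in the order `π`, the first one from `wInit`. Induction on
-- the position `n` under `π` follows these edges: a shared edge places the thread right after its
-- predecessor in `ρ` too.
reads-from-determines : ∀ {N} {π ρ : Permutation′ N} →
  (∀ x y → stage π (wr x) ≡ stage π (rd y) → stage ρ (wr x) ≡ stage ρ (rd y)) → π ≈ ρ
reads-from-determines {π = π} {ρ} rf i = go _ i refl
  where
  go : ∀ n i → toℕ (π ⟨$⟩ʳ i) ≡ n → π ⟨$⟩ʳ i ≡ ρ ⟨$⟩ʳ i
  go n i _ with stage-wr-surjective π (stage π (rd (r i)))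
  ... | wInit , eq = Fin.inject₁-injective (trans (sym eq) (rf wInit (r i) eq))
  go zero i πi≡0 | w j , eq with () ← trans (cong toℕ eq) (trans (Fin.toℕ-inject₁ _) πi≡0)
  go (suc n) i πi≡1+n | w j , eq = Fin.inject₁-injective (trans (sym eq)
    (trans (cong suc (go n j πj≡n)) (rf (w j) (r i) eq)))
    where πj≡n = ℕ.suc-injective (trans (cong toℕ eq) (trans (Fin.toℕ-inject₁ _) πi≡1+n))

theorem4p3 : ∀ {ℓ} (𝒯 : Theory ℓ) (N : ℕ) → N ≥ 1 →
    Σ[ M ∈ Model 𝒯 ]
    AtLeast (2 * N + 2) (StrictTotalOrder.Eq.setoid (Model.clock M)) ×
    AtLeast (suc N) (Model.selection M) →
    Representable (Theory.valueTheory 𝒯) (suc N) →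
    ∀ {𝒳 : Set} (abs : Abstraction (φ² N) 𝒳)
    (π : UnsatProof 𝒯 (φ² N) abs) →
    N ! ≤ #learn 𝒯 (φ² N) abs π
theorem4p3 𝒯 N _ (M , clocks , selections) representable abs proof =
  subst (_≤ #learn 𝒯 (φ² N) abs proof) (length-tabulate {n = N !} (λ i → i))
    (length≤#learn proof (Unique.allFin⁺ (N !)))
  where
  values : Counting (Theory.value 𝒯) N
  values = counting (Theory.valueTheory 𝒯) N representable

  separated : ∀ {i j} → i ≢ j → ∀ {L} → All (λ l → atom l ∈Atoms φ² N) L → 𝒯 ⊨ L →
              Any (HoldsLiteral (Holds (permutation N i))) L ⊎
              Any (HoldsLiteral (Holds (permutation N j))) L
  separated {i} {j} i≢j {L} L⊆ ⊨L
    with Any.any? (holdsLiteral? (holds? (permutation N i))) L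
       | Any.any? (holdsLiteral? (holds? (permutation N j))) L
  ... | yes holdsᵢ | _          = inj₁ holdsᵢ
  ... | no  _      | yes holdsⱼ = inj₂ holdsⱼ
  -- An edge of one execution missing in the other would make `β` falsify the valid clause. Hence
  -- all edges are shared and the permutations agree.
  ... | no  ¬holdsᵢ | no ¬holdsⱼ = contradiction
    (permutation-injective N (reads-from-determines λ x y xᵢ-yᵢ →
      decidable-stable (_ Fin.≟ _) λ xⱼ≁yⱼ →
        let open Separation {𝒯 = 𝒯} M clocks selections values _ _ x y xᵢ-yᵢ xⱼ≁yⱼ in
        ⊨L M β (falsified L⊆ ¬holdsᵢ ¬holdsⱼ)))
    i≢j

  open CriticalAssignments 𝒯 (φ² N) abs (Holds ∘ permutation N) (holds? ∘ permutation N)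
    (λ {i} → holds-resp-≅ (permutation N i)) (holds-φ² ∘ permutation N) separated
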